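{- Let $X$ be a finite nonempty set of cardinality $n$ and let $N=\binom{n}{2}$. The number of idempotent elements in $\mathcal{M}(X)$ is exactly $$\sum_{d=1}^n\binom{n}{d}d^{\,n-d}\sum_{a=0}^{N}\binom{N}{a}(2a+d)^{N-a}.$$
   Context: $\mathcal{M}(X)=X^{X\times X}$ is the set of all binary operations on $X$, a monoid under $\triangleright$ defined by $a(\circ\triangleright\ast)b=(a\circ b)\ast(b\circ a)$ for all $a,b\in X$. An element $\ast\in\mathcal{M}(X)$ is idempotent if $\ast\triangleright\ast=\ast$. -}

module Defs where

open import Algebra.Bundles using (Monoid)
open import Algebra.Core using (Op₂)
open import Algebra.Definitions using (_IdempotentOn_)
open import Data.Nat.Properties using (+-0-commutativeMonoid)
open import Data.Product using (Σ; _×_; _,_; proj₁)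
open import Level using (Level; _⊔_)
open import Relation.Binary.Bundles using (Setoid)
import Relation.Binary.Construct.On as On
open import Relation.Binary.PropositionalEquality
  using (_→-setoid_; refl; trans; cong; cong₂)

open import Algebra.Properties.CommutativeMonoid.Sum +-0-commutativeMonoid public
  using (sum-syntax; sum⁺-syntax)

private
  variable
    c ℓ : Level

infixl 7 _▷_

_▷_ : {X : Set ℓ} → Op₂ (X × X → X)
(f ▷ g) (a , b) = g (f (a , b) , f (b , a))

-- Functions cannot be shown propositionally equal without function
-- extensionality, so operations are compared pointwise.
𝓜 : Set ℓ → Monoid ℓ ℓ
𝓜 X = record
  { Carrier  = X × X → X
  ; _≈_      = Setoid._≈_ ((X × X) →-setoid X)
  ; _∙_      = _▷_
  ; ε        = proj₁
  ; isMonoid = record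
    { isSemigroup = record
      { isMagma = record
        { isEquivalence = Setoid.isEquivalence ((X × X) →-setoid X)
        ; ∙-cong = λ { {f} {f′} {g} f≈f′ g≈g′ (a , b) →
            trans (cong g (cong₂ _,_ (f≈f′ (a , b)) (f≈f′ (b , a)))) (g≈g′ _) }
        }
      ; assoc = λ _ _ _ _ → refl
      }
    ; identity = (λ _ _ → refl) , (λ _ _ → refl)
    }
  }

-- Equality of idempotents ignores the proof component, so that each
-- idempotent element is counted once.
Idempotents : Monoid c ℓ → Setoid (c ⊔ ℓ) ℓ
Idempotents M = On.setoid {B = Σ Carrier (_IdempotentOn_ _≈_ _∙_)} setoid proj₁
  where open Monoid M

{-# OPTIONS --safe #-}

-- An operation f on X is the same as the self-map (a , b) ↦ (f (a , b) , f (b , a))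
-- of X × X, which commutes with the swap, and ▷ becomes composition.  Under the
-- swap, X × X splits into n fixed points (the diagonal) and N two-element orbits,
-- so such a map is given by a map g on the diagonal together with an arbitrary
-- value h p for one representative of each orbit p.  It is idempotent exactly when
-- every value is a fixed point.  If the fixed points are d diagonal points and
-- a orbits, the other n − d diagonal points have d possible values each, and the
-- other N − a representatives have 2 a + d.
module Submission where

open import Defs
open import Data.Bool using (Bool; true; false; not)
open import Data.Bool.Properties using (not-involutive) renaming (_≟_ to _≟ᵇ_)
open import Data.Empty using (⊥; ⊥-elim)
open import Data.Fin using (Fin; zero; suc; toℕ; fromℕ; inject₁; _≟_)
open import Data.Fin.Properties
  using (+↔⊎; *↔×; 0↔⊥; 1↔⊤; 2↔Bool; toℕ-fromℕ; toℕ-inject₁)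
open import Data.Fin.Subset using (Side; Subset; inside; outside; _∈_; ∣_∣; ∁)
open import Data.Fin.Subset.Properties using (drop-there; ∣∁p∣≡n∸∣p∣; ⊆-antisym)
open import Data.Nat using (ℕ; zero; suc; _+_; _*_; _∸_; _^_; NonZero)
open import Data.Nat.Combinatorics
  using (_C_; nC1≡n; nCk+nC[k+1]≡[n+1]C[k+1]; k>n⇒nCk≡0)
open import Data.Nat.Properties
  using ( +-0-commutativeMonoid; +-assoc; +-comm; +-identityʳ
        ; *-assoc; *-comm; *-identityˡ; *-distribʳ-+; n<1+n)
open import Data.Product
  using (Σ; ∃; _×_; _,_; proj₁; proj₂; uncurry; map₁; map₂; swap)
import Data.Product as Product
open import Data.Product.Function.NonDependent.Propositional using (_×-↔_)
import Data.Product.Properties as Product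
open import Data.Sum using (_⊎_; inj₁; inj₂; [_,_])
import Data.Sum as Sum
open import Data.Sum.Function.Propositional using (_⊎-↔_)
open import Data.Sum.Properties using (inj₁-injective)
import Data.Sum.Properties as Sum
open import Data.Unit using (⊤; tt)
open import Data.Vec using (Vec; []; _∷_; lookup; tabulate; here; there)
open import Data.Vec.Properties
  using (lookup∘tabulate; tabulate∘lookup; tabulate-cong; lookup⇒[]=; []=⇒lookup)
open import Algebra.Properties.CommutativeMonoid.Sum +-0-commutativeMonoid
  using (sum-cong-≗; ∑-distrib-+; sum-init-last)
open import Function.Base using (_∘_; id)
open import Function.Bundles using (_↔_; Inverse; mk↔ₛ′)
open import Function.Construct.Composition using (_↔-∘_)
open import Function.Construct.Identity using (↔-id)
open import Function.Construct.Symmetry using (↔-sym)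
open import Level using (Level)
open import Relation.Binary.Definitions using (DecidableEquality)
open import Relation.Binary.PropositionalEquality
  using (_≡_; _≗_; refl; sym; trans; cong; cong₂; subst; setoid; module ≡-Reasoning)
open import Relation.Nullary using (¬_; does; yes; no)
open import Relation.Nullary.Decidable using (dec-true)

private
  variable
    ℓ : Level
    A B D E : Set
    P Q : A → Set
    I I′ : Set
    j k n : ℕ

-- Enumerations of the elements that satisfy a predicate.

record Enumeration {A : Set} (P : A → Set) (I : Set) : Set where
  field
    enum      : I → A
    sound     : ∀ i → P (enum i)
    injective : ∀ {i j} → enum i ≡ enum j → i ≡ j
    complete  : ∀ {a} → P a → ∃ λ i → enum i ≡ a

open Enumeration

reindex : I′ ↔ I → Enumeration P I → Enumeration P I′
reindex {P = P} φ e = record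
  { enum      = enum e ∘ Inverse.to φ
  ; sound     = sound e ∘ Inverse.to φ
  ; injective = λ eq → trans (sym (Inverse.strictlyInverseʳ φ _))
                  (trans (cong (Inverse.from φ) (injective e eq)) (Inverse.strictlyInverseʳ φ _))
  ; complete  = λ p → let i , eq = complete e p in
                  Inverse.from φ i , trans (cong (enum e) (Inverse.strictlyInverseˡ φ i)) eq
  }

image : Enumeration P I → (f : A → B) → (∀ {x y} → f x ≡ f y → x ≡ y) →
        (∀ {a} → P a → Q (f a)) → (∀ {b} → Q b → ∃ λ a → P a × f a ≡ b) → Enumeration Q I
image e f f-inj P⇒Q Q⇒P = record
  { enum      = f ∘ enum e
  ; sound     = P⇒Q ∘ sound e
  ; injective = injective e ∘ f-inj
  ; complete  = λ q → let a , p , fa≡b = Q⇒P q ; i , eq = complete e p in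
                  i , trans (cong f eq) fa≡b
  }

respects : Enumeration P I → (∀ {a} → P a → Q a) → (∀ {a} → Q a → P a) → Enumeration Q I
respects e P⇒Q Q⇒P = image e id id P⇒Q (λ q → _ , Q⇒P q , refl)

universal : Enumeration {A} (λ _ → ⊤) A
universal = record { enum = id ; sound = λ _ → tt ; injective = id ; complete = λ _ → _ , refl }

singleton : (a : A) → Enumeration (_≡ a) ⊤
singleton a = record
  { enum = λ _ → a ; sound = λ _ → refl ; injective = λ _ → refl ; complete = λ eq → tt , sym eq }

disjointUnion : (∀ {a} → P a → ¬ Q a) →
                Enumeration P I → Enumeration Q I′ → Enumeration (λ a → P a ⊎ Q a) (I ⊎ I′)
disjointUnion {Q = Q} disj d e = record
  { enum      = [ enum d , enum e ]
  ; sound     = λ { (inj₁ i) → inj₁ (sound d i) ; (inj₂ j) → inj₂ (sound e j) }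
  ; injective = λ
    { {inj₁ _} {inj₁ _} eq → cong inj₁ (injective d eq)
    ; {inj₁ i} {inj₂ j} eq → ⊥-elim (disj (sound d i) (subst Q (sym eq) (sound e j)))
    ; {inj₂ j} {inj₁ i} eq → ⊥-elim (disj (sound d i) (subst Q eq (sound e j)))
    ; {inj₂ _} {inj₂ _} eq → cong inj₂ (injective e eq)
    }
  ; complete  = λ
    { (inj₁ p) → let i , eq = complete d p in inj₁ i , eq
    ; (inj₂ q) → let j , eq = complete e q in inj₂ j , eq
    }
  }

product : Enumeration P I → Enumeration Q I′ →
          Enumeration (λ (a , b) → P a × Q b) (I × I′)
product d e = record
  { enum      = λ (i , j) → enum d i , enum e j
  ; sound     = λ (i , j) → sound d i , sound e j
  ; injective = λ eq → cong₂ _,_ (injective d (Product.,-injectiveˡ eq))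
                                (injective e (Product.,-injectiveʳ eq))
  ; complete  = λ (p , q) → let i , eq₁ = complete d p ; j , eq₂ = complete e q in
                  (i , j) , cong₂ _,_ eq₁ eq₂
  }

Counts : (A → Set) → ℕ → Set
Counts P k = Enumeration P (Fin k)

counts-⊎ : (∀ {a} → P a → ¬ Q a) → Counts P j → Counts Q k → Counts (λ a → P a ⊎ Q a) (j + k)
counts-⊎ disj d e = reindex +↔⊎ (disjointUnion disj d e)

counts-× : Counts P j → Counts Q k → Counts (λ (a , b) → P a × Q b) (j * k)
counts-× d e = reindex *↔× (product d e)

-- Counting the members of a subset and the maps prescribed on it.

counts-∈ : (S : Subset n) → Counts (_∈ S) ∣ S ∣
counts-∈ [] = record
  { enum = λ () ; sound = λ () ; injective = λ { {()} } ; complete = λ () }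
counts-∈ (inside ∷ S) = respects
  (counts-⊎ (λ { refl (_ , _ , ()) }) (reindex 1↔⊤ (singleton zero))
    (image (counts-∈ S) suc (λ { refl → refl }) (λ x∈S → _ , x∈S , refl) id))
  (λ { (inj₁ refl) → here ; (inj₂ (_ , x∈S , refl)) → there x∈S })
  (λ { here → inj₁ refl ; (there x∈S) → inj₂ (_ , x∈S , refl) })
counts-∈ (outside ∷ S) =
  image (counts-∈ S) suc (λ { refl → refl }) there (λ { (there x∈S) → _ , x∈S , refl })

-- With `P` membership in `S` and `ι` the identity, these are the retractions of `Fin n` onto `S`.
-- Maps are stored as vectors because `complete` asks for propositional equality.
SendsInto_FixingOn_via_ : (A → Set) → Subset n → (Fin n → A) → Vec A n → Set
(SendsInto P FixingOn S via ι) v =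
  ∀ x → P (lookup v x) × (x ∈ S → lookup v x ≡ ι x)

-- A coordinate in `S` is forced and contributes a factor `1`; every other coordinate ranges freely
-- over the `k` elements of `P`.
counts-retractions-∁ : (S : Subset n) (ι : Fin n → A) → (∀ {x} → x ∈ S → P (ι x)) → Counts P k →
                     Counts (SendsInto P FixingOn S via ι) (k ^ ∣ ∁ S ∣)
counts-retractions-∁ [] ι _ e =
  respects (reindex 1↔⊤ (singleton [])) (λ _ ()) (λ { {[]} _ → refl })
counts-retractions-∁ {k = k} (inside ∷ S) ι ι∈P e =
  subst (Counts _) (*-identityˡ (k ^ ∣ ∁ S ∣))
    (image (counts-× (reindex 1↔⊤ (singleton (ι zero)))
                     (counts-retractions-∁ S (ι ∘ suc) (ι∈P ∘ there) e))
      (uncurry _∷_) (λ { refl → refl })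
      (λ { (refl , p) → λ { zero    → ι∈P here , (λ _ → refl)
                          ; (suc x) → map₂ (_∘ drop-there) (p x) } })
      (λ { {y ∷ v} p → (y , v) , (proj₂ (p zero) here , map₂ (_∘ there) ∘ p ∘ suc) , refl }))
counts-retractions-∁ (outside ∷ S) ι ι∈P e =
  image (counts-× e (counts-retractions-∁ S (ι ∘ suc) (ι∈P ∘ there) e))
    (uncurry _∷_) (λ { refl → refl })
    (λ (p₀ , p) → λ { zero → p₀ , (λ ()) ; (suc x) → map₂ (_∘ drop-there) (p x) })
    (λ { {y ∷ v} p → (y , v) , (proj₁ (p zero) , map₂ (_∘ there) ∘ p ∘ suc) , refl })

counts-retractions : (S : Subset n) (ι : Fin n → A) → (∀ {x} → x ∈ S → P (ι x)) → Counts P k →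
                     Counts (SendsInto P FixingOn S via ι) (k ^ (n ∸ ∣ S ∣))
counts-retractions S ι ι∈P e rewrite sym (∣∁p∣≡n∸∣p∣ S) = counts-retractions-∁ S ι ι∈P e

-- Sums over subsets, grouped by cardinality.

sum-pascal : ∀ n (w : ℕ → ℕ) →
  ∑[ i ≤ n ] ((n C toℕ i) * w (suc (toℕ i))) + ∑[ i ≤ n ] ((n C toℕ i) * w (toℕ i)) ≡
  ∑[ i ≤ suc n ] ((suc n C toℕ i) * w (toℕ i))
sum-pascal n w = begin
  ∑[ i ≤ n ] a (toℕ i) + ∑[ i ≤ n ] b (toℕ i)
    -- Appending the vanishing term at `suc n` lets `b 0` be split off while leaving a sum as long
    -- as the first, so that Pascal's rule applies term by term.
    ≡⟨ cong (∑[ i ≤ n ] a (toℕ i) +_) extend ⟩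
  ∑[ i ≤ n ] a (toℕ i) + (b 0 + ∑[ i ≤ n ] b (suc (toℕ i)))
    ≡⟨ +-assoc (∑[ i ≤ n ] a (toℕ i)) (b 0) _ ⟨
  ∑[ i ≤ n ] a (toℕ i) + b 0 + ∑[ i ≤ n ] b (suc (toℕ i))
    ≡⟨ cong (_+ ∑[ i ≤ n ] b (suc (toℕ i))) (+-comm _ (b 0)) ⟩
  b 0 + ∑[ i ≤ n ] a (toℕ i) + ∑[ i ≤ n ] b (suc (toℕ i))
    ≡⟨ +-assoc (b 0) _ _ ⟩
  b 0 + (∑[ i ≤ n ] a (toℕ i) + ∑[ i ≤ n ] b (suc (toℕ i)))
    ≡⟨ cong (b 0 +_) (∑-distrib-+ {suc n} (λ i → a (toℕ i)) (λ i → b (suc (toℕ i)))) ⟨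
  b 0 + ∑[ i ≤ n ] (a (toℕ i) + b (suc (toℕ i)))
    ≡⟨ cong (b 0 +_) (sum-cong-≗ {suc n} (λ i → pascal (toℕ i))) ⟩
  ∑[ i ≤ suc n ] ((suc n C toℕ i) * w (toℕ i)) ∎
  where
  open ≡-Reasoning
  a b : ℕ → ℕ
  a m = (n C m) * w (suc m)
  b m = (n C m) * w m
  pascal : ∀ m → a m + b (suc m) ≡ (suc n C suc m) * w (suc m)
  pascal m = trans (sym (*-distribʳ-+ (w (suc m)) (n C m) (n C suc m)))
                   (cong (_* w (suc m)) (nCk+nC[k+1]≡[n+1]C[k+1] n m))
  extend : ∑[ i ≤ n ] b (toℕ i) ≡ ∑[ i ≤ suc n ] b (toℕ i)
  extend = sym (begin
    ∑[ i ≤ suc n ] b (toℕ i)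
      ≡⟨ sum-init-last {suc n} (λ i → b (toℕ i)) ⟩
    ∑[ i ≤ n ] b (toℕ (inject₁ i)) + b (toℕ (fromℕ (suc n)))
      ≡⟨ cong₂ _+_ (sum-cong-≗ {suc n} (λ i → cong b (toℕ-inject₁ i)))
                   (cong b (toℕ-fromℕ (suc n))) ⟩
    ∑[ i ≤ n ] b (toℕ i) + b (suc n)
      ≡⟨ cong (λ c → ∑[ i ≤ n ] b (toℕ i) + c * w (suc n)) (k>n⇒nCk≡0 (n<1+n n)) ⟩
    ∑[ i ≤ n ] b (toℕ i) + 0
      ≡⟨ +-identityʳ _ ⟩
    ∑[ i ≤ n ] b (toℕ i) ∎)

-- The fibre over `S` has a size depending only on the cardinality of `S`, and `n C i` subsets have
-- cardinality `i`. The induction splits on whether the first element belongs to `S`; the weight is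
-- arbitrary so that it can be shifted to `w ∘ suc` when it does.
counts-subsets : ∀ n {P : Subset n × A → Set} (w : ℕ → ℕ) →
  (∀ S → Counts (λ a → P (S , a)) (w ∣ S ∣)) →
  Counts P (∑[ i ≤ n ] ((n C toℕ i) * w (toℕ i)))
counts-subsets zero w e = subst (Counts _) (sym (trans (+-identityʳ _) (*-identityˡ _)))
  (image (e []) ([] ,_) (λ { refl → refl }) id (λ { {[] , _} p → _ , p , refl }))
counts-subsets {A = A} (suc n) {P} w e = subst (Counts P) (sum-pascal n w)
  (respects
    (counts-⊎ (λ { (_ , _ , refl) (_ , _ , ()) })
      (extend inside (counts-subsets n (w ∘ suc) (e ∘ (inside ∷_))))
      (extend outside (counts-subsets n w (e ∘ (outside ∷_)))))
    [ (λ { (_ , p , refl) → p }) , (λ { (_ , p , refl) → p }) ]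
    (λ { {inside ∷ _ , _} p → inj₁ (_ , p , refl) ; {outside ∷ _ , _} p → inj₂ (_ , p , refl) }))
  where
  cons : Side → Subset n × A → Subset (suc n) × A
  cons s (S , a) = s ∷ S , a
  extend : ∀ s → Counts (P ∘ cons s) k → Counts (λ b → ∃ λ a → P (cons s a) × cons s a ≡ b) k
  extend s c = image c (cons s) (λ { refl → refl }) (λ p → _ , p , refl) id

-- The set on which two maps agree.

agreement : DecidableEquality A → (u v : Fin n → A) → Subset n
agreement _≈?_ u v = tabulate (λ x → does (u x ≈? v x))

module _ (_≈?_ : DecidableEquality A) (u v : Fin n → A) where

  ∈-agreement⁺ : ∀ {x} → u x ≡ v x → x ∈ agreement _≈?_ u v
  ∈-agreement⁺ {x} eq = lookup⇒[]= x _ (trans (lookup∘tabulate _ x) (dec-true (u x ≈? v x) eq))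

  ∈-agreement⁻ : ∀ {x} → x ∈ agreement _≈?_ u v → u x ≡ v x
  ∈-agreement⁻ {x} x∈
    with u x ≈? v x
       | trans (sym (lookup∘tabulate (λ x → does (u x ≈? v x)) x)) ([]=⇒lookup x∈)
  ... | yes eq | _  = eq
  ... | no _   | ()

  -- With `v` the identity or `base`, the agreement set is a set of fixed points; this recovers the
  -- fixed set recorded in a code from the map alone.
  agreement-unique : ∀ {S} → (∀ {x} → x ∈ S → u x ≡ v x) → (∀ {x} → u x ≡ v x → x ∈ S) →
                     agreement _≈?_ u v ≡ S
  agreement-unique S⇒ ⇒S = ⊆-antisym (⇒S ∘ ∈-agreement⁻) (∈-agreement⁺ ∘ S⇒)

-- The swap on the square and its orbits.

flip : D ⊎ E × Bool → D ⊎ E × Bool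
flip = Sum.map₂ (map₂ not)

flip-involutive : (y : D ⊎ E × Bool) → flip (flip y) ≡ y
flip-involutive (inj₁ _)       = refl
flip-involutive (inj₂ (p , b)) = cong (λ c → inj₂ (p , c)) (not-involutive b)

-- D indexes the diagonal and E the unordered pairs; (e , false) and (e , true) are
-- the two orderings of the pair e.
record SymmetricSquare (X : Set ℓ) (D E : Set) : Set ℓ where
  field
    diagonal : D ↔ X
    square   : (X × X) ↔ (D ⊎ E × Bool)

  open Inverse diagonal public using () renaming
    (to to point; from to coordinate)
  open Inverse square public using () renaming
    (to to classify; from to represent
    ; strictlyInverseˡ to classify∘represent; strictlyInverseʳ to represent∘classify)

  field
    represent-diagonal : ∀ x → represent (inj₁ x) ≡ (point x , point x)
    classify-swap      : ∀ z → classify (swap z) ≡ flip (classify z)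

  represent-flip : ∀ y → represent (flip y) ≡ swap (represent y)
  represent-flip y = begin
    represent (flip y)                        ≡⟨ cong (represent ∘ flip) (classify∘represent y) ⟨
    represent (flip (classify (represent y))) ≡⟨ cong represent (classify-swap (represent y)) ⟨
    represent (classify (swap (represent y))) ≡⟨ represent∘classify _ ⟩
    swap (represent y)                        ∎
    where open ≡-Reasoning

-- Codes for idempotent maps that commute with the flip.

module _ {n N : ℕ} where

  private
    Y : Set
    Y = Fin n ⊎ Fin N × Bool

    base : Fin N → Y
    base p = inj₂ (p , false)

    _≟Y_ : DecidableEquality Y
    _≟Y_ = Sum.≡-dec _≟_ (Product.≡-dec _≟_ _≟ᵇ_)

  -- (S , g , T , h): the fixed points S and fixed orbits T are determined by g and h,
  -- but once they are chosen the values of g and h are constrained independently.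
  Code : Set
  Code = Subset n × Vec (Fin n) n × Subset N × Vec Y N

  -- The intended set of fixed points. A map commuting with the flip fixes both orderings of a pair
  -- or neither, so the boolean does not enter.
  Member : Subset n → Subset N → Y → Set
  Member S T (inj₁ x)       = x ∈ S
  Member S T (inj₂ (p , _)) = p ∈ T

  Valid : Code → Set
  Valid (S , g , T , h) =
    (SendsInto (_∈ S) FixingOn S via id) g × (SendsInto (Member S T) FixingOn T via base) h

  -- Each orbit in `T` contributes both of its orderings, whence the factor `2`.
  counts-Member : ∀ S T → Counts (Member S T) (∣ S ∣ + ∣ T ∣ * 2)
  counts-Member S T = respects
    (counts-⊎ (λ { (_ , _ , refl) (_ , _ , ()) })
      (image (counts-∈ S) inj₁ (λ { refl → refl }) (λ x∈S → _ , x∈S , refl) id)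
      (image (counts-× (counts-∈ T) (reindex 2↔Bool universal))
        inj₂ (λ { refl → refl }) (λ p → _ , p , refl) id))
    [ (λ { (_ , x∈S , refl) → x∈S }) , (λ { (_ , (p∈T , _) , refl) → p∈T }) ]
    (λ { {inj₁ _} x∈S → inj₁ (_ , x∈S , refl) ; {inj₂ _} p∈T → inj₂ (_ , (p∈T , tt) , refl) })

  -- Once `S` is fixed, `g` is independent of the pair `(T , h)`; hence a sum over `S` of a product
  -- whose second factor is itself a sum over `T`.
  counts-Valid : Counts Valid
    (∑[ i ≤ n ] ((n C toℕ i) * (toℕ i ^ (n ∸ toℕ i) *
      ∑[ j ≤ N ] ((N C toℕ j) * (toℕ i + toℕ j * 2) ^ (N ∸ toℕ j)))))
  counts-Valid =
    counts-subsets n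
      (λ d → d ^ (n ∸ d) * ∑[ j ≤ N ] ((N C toℕ j) * (d + toℕ j * 2) ^ (N ∸ toℕ j)))
      λ S → counts-×
        (counts-retractions S id id (counts-∈ S))
        (counts-subsets N (λ a → (∣ S ∣ + a * 2) ^ (N ∸ a))
          λ T → counts-retractions T base id (counts-Member S T))

  -- The only map commuting with `flip` that has these values on the diagonal and at the
  -- representatives: the value at `(p , true)` is forced.
  extend : (Fin n → Fin n) → (Fin N → Y) → Y → Y
  extend g h (inj₁ x)           = inj₁ (g x)
  extend g h (inj₂ (p , false)) = h p
  extend g h (inj₂ (p , true))  = flip (h p)

  extend-cong : ∀ {g g′ h h′} → g ≗ g′ → h ≗ h′ → extend g h ≗ extend g′ h′
  extend-cong g≗ h≗ (inj₁ x)           = cong inj₁ (g≗ x)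
  extend-cong g≗ h≗ (inj₂ (p , false)) = h≗ p
  extend-cong g≗ h≗ (inj₂ (p , true))  = cong flip (h≗ p)

  extend-flip : ∀ g h y → extend g h (flip y) ≡ flip (extend g h y)
  extend-flip g h (inj₁ x)           = refl
  extend-flip g h (inj₂ (p , false)) = refl
  extend-flip g h (inj₂ (p , true))  = sym (flip-involutive (h p))

  codeOf : (Fin n → Fin n) → (Fin N → Y) → Code
  codeOf g h = agreement _≟_ g id , tabulate g , agreement _≟Y_ h base , tabulate h

  codeOf-cong : ∀ {g g′ h h′} → g ≗ g′ → h ≗ h′ → codeOf g h ≡ codeOf g′ h′
  codeOf-cong g≗ h≗ =
    cong₂ _,_ (tabulate-cong λ x → cong (λ y → does (y ≟ x)) (g≗ x))
      (cong₂ _,_ (tabulate-cong g≗)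
        (cong₂ _,_ (tabulate-cong λ p → cong (λ y → does (y ≟Y base p)) (h≗ p))
          (tabulate-cong h≗)))

  -- Validity makes `S` consist of fixed points of `g`; conversely a fixed `x` equals its own value,
  -- which lies in `S`. The same argument applies to `T` and `h`.
  codeOf-lookup : ∀ (c@(_ , g , _ , h) : Code) → Valid c → codeOf (lookup g) (lookup h) ≡ c
  codeOf-lookup (S , g , T , h) (gv , hv) =
    cong₂ _,_
      (agreement-unique _≟_ (lookup g) id (proj₂ (gv _))
        (λ {x} eq → subst (_∈ S) eq (proj₁ (gv x))))
      (cong₂ _,_ (tabulate∘lookup g)
        (cong₂ _,_
          (agreement-unique _≟Y_ (lookup h) base (proj₂ (hv _))
            (λ {p} eq → subst (Member S T) eq (proj₁ (hv p))))
          (tabulate∘lookup h)))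

  idempotent⇒valid : ∀ {g h} → (∀ y → extend g h (extend g h y) ≡ extend g h y) →
                     Valid (codeOf g h)
  idempotent⇒valid {g} {h} idem =
    (λ x → subst (λ y → y ∈ S × (x ∈ S → y ≡ x)) (sym (lookup∘tabulate g x))
             (∈-agreement⁺ _≟_ g id (inj₁-injective (idem (inj₁ x))) , ∈-agreement⁻ _≟_ g id)) ,
    (λ p → subst (λ y → Member S T y × (p ∈ T → y ≡ base p)) (sym (lookup∘tabulate h p))
             (member (h p) (idem (base p)) , ∈-agreement⁻ _≟Y_ h base))
    where
    S = agreement _≟_ g id
    T = agreement _≟Y_ h base
    member : ∀ y → extend g h y ≡ y → Member S T y
    member (inj₁ x)           eq = ∈-agreement⁺ _≟_ g id (inj₁-injective eq)
    member (inj₂ (q , false)) eq = ∈-agreement⁺ _≟Y_ h base eq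
    member (inj₂ (q , true))  eq =
      -- Flipping both sides moves the fixed-point equation from the second ordering to the
      -- representative.
      ∈-agreement⁺ _≟Y_ h base (trans (sym (flip-involutive (h q))) (cong flip eq))

  -- `G` takes all its values among the members and fixes every member.
  valid⇒idempotent : ∀ (c@(_ , g , _ , h) : Code) → Valid c →
    let G = extend (lookup g) (lookup h) in ∀ y → G (G y) ≡ G y
  valid⇒idempotent (S , g , T , h) (gv , hv) y = fixes (G y) (lands y)
    where
    G = extend (lookup g) (lookup h)
    fixes : ∀ y → Member S T y → G y ≡ y
    fixes (inj₁ x)           x∈S = cong inj₁ (proj₂ (gv x) x∈S)
    fixes (inj₂ (p , false)) p∈T = proj₂ (hv p) p∈T
    fixes (inj₂ (p , true))  p∈T = cong flip (proj₂ (hv p) p∈T)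
    member-flip : ∀ y → Member S T y → Member S T (flip y)
    member-flip (inj₁ _) m = m
    member-flip (inj₂ _) m = m
    lands : ∀ y → Member S T (G y)
    lands (inj₁ x)           = proj₁ (gv x)
    lands (inj₂ (p , false)) = proj₁ (hv p)
    lands (inj₂ (p , true))  = member-flip (lookup h p) (proj₁ (hv p))

  -- Passing between operations on `X` and codes.

  module _ {X : Set ℓ} (sq : SymmetricSquare X (Fin n) (Fin N)) where
    open SymmetricSquare sq
    open ≡-Reasoning

    -- The self-map of the square attached to `f`: `f ▷ g` is `g ∘ both f`, so `Idempotent f`
    -- unfolds to idempotence in the monoid.
    both : (X × X → X) → X × X → X × X
    both f z = f z , f (swap z)

    Idempotent : (X × X → X) → Set ℓ
    Idempotent f = ∀ z → f (both f z) ≡ f z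

    onDiagonal : (X × X → X) → Fin n → Fin n
    onDiagonal f x = coordinate (f (point x , point x))

    offDiagonal : (X × X → X) → Fin N → Y
    offDiagonal f p = classify (both f (represent (base p)))

    -- `both f` commutes with the swap, so its values on the diagonal and at the representatives
    -- determine it. In these coordinates it is therefore an `extend`.
    both-represent : ∀ f y →
      extend (onDiagonal f) (offDiagonal f) y ≡ classify (both f (represent y))
    both-represent f (inj₁ x) = begin
      inj₁ (onDiagonal f x)                        ≡⟨ classify∘represent _ ⟨
      classify (represent (inj₁ (onDiagonal f x))) ≡⟨ cong classify (represent-diagonal _) ⟩
      classify (point (onDiagonal f x) , point (onDiagonal f x))
        ≡⟨ cong (λ z → classify (z , z)) (Inverse.strictlyInverseˡ diagonal _) ⟩
      classify (both f (point x , point x))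
        ≡⟨ cong (classify ∘ both f) (represent-diagonal x) ⟨
      classify (both f (represent (inj₁ x)))       ∎
    both-represent f (inj₂ (p , false)) = refl
    both-represent f (inj₂ (p , true))  = begin
      flip (classify (both f (represent (base p)))) ≡⟨ classify-swap _ ⟨
      classify (both f (swap (represent (base p))))
        ≡⟨ cong (classify ∘ both f) (represent-flip (base p)) ⟨
      classify (both f (represent (inj₂ (p , true)))) ∎

    encode : (X × X → X) → Code
    encode f = codeOf (onDiagonal f) (offDiagonal f)

    encode-cong : ∀ {f f′} → f ≗ f′ → encode f ≡ encode f′
    encode-cong f≗f′ = codeOf-cong
      (λ x → cong coordinate (f≗f′ _)) (λ p → cong classify (cong₂ _,_ (f≗f′ _) (f≗f′ _)))

    encode-valid : ∀ {f} → Idempotent f → Valid (encode f)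
    encode-valid {f} idem = idempotent⇒valid λ y → begin
      G (G y)                                                  ≡⟨ cong G (both-represent f y) ⟩
      G (classify (both f (represent y)))                      ≡⟨ both-represent f _ ⟩
      classify (both f (represent (classify (both f (represent y)))))
        ≡⟨ cong (classify ∘ both f) (represent∘classify _) ⟩
      classify (both f (both f (represent y)))
        -- The two coordinates need idempotence at a pair and at its swap.
        ≡⟨ cong classify (cong₂ _,_ (idem (represent y)) (idem (swap (represent y)))) ⟩
      classify (both f (represent y))                          ≡⟨ both-represent f y ⟨
      G y                                                      ∎
      where G = extend (onDiagonal f) (offDiagonal f)

    decode : Code → X × X → X
    decode (_ , g , _ , h) z =
      proj₁ (represent (extend (lookup g) (lookup h) (classify z)))

    -- `decode` keeps only the first coordinate; the second is the first coordinate at the swapped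
    -- pair, because `extend` commutes with the flip.
    both-decode : ∀ (c@(_ , g , _ , h) : Code) z →
      both (decode c) z ≡ represent (extend (lookup g) (lookup h) (classify z))
    both-decode c@(_ , g , _ , h) z = cong (decode c z ,_) (begin
      proj₁ (represent (G (classify (swap z)))) ≡⟨ cong (proj₁ ∘ represent ∘ G) (classify-swap z) ⟩
      proj₁ (represent (G (flip (classify z))))
        ≡⟨ cong (proj₁ ∘ represent) (extend-flip _ _ (classify z)) ⟩
      proj₁ (represent (flip (G (classify z)))) ≡⟨ cong proj₁ (represent-flip (G (classify z))) ⟩
      proj₂ (represent (G (classify z)))        ∎)
      where G = extend (lookup g) (lookup h)

    decode-idempotent : ∀ c → Valid c → Idempotent (decode c)
    decode-idempotent c@(_ , g , _ , h) v z = begin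
      decode c (both (decode c) z)                              ≡⟨ cong (decode c) (both-decode c z) ⟩
      proj₁ (represent (G (classify (represent (G (classify z))))))
        ≡⟨ cong (proj₁ ∘ represent ∘ G) (classify∘represent _) ⟩
      proj₁ (represent (G (G (classify z))))
        ≡⟨ cong (proj₁ ∘ represent) (valid⇒idempotent c v (classify z)) ⟩
      decode c z                                                ∎
      where G = extend (lookup g) (lookup h)

    encode∘decode : ∀ c → Valid c → encode (decode c) ≡ c
    encode∘decode c@(_ , g , _ , h) v = trans (codeOf-cong g≗ h≗) (codeOf-lookup c v)
      where
      G = extend (lookup g) (lookup h)
      G-both : ∀ y → classify (both (decode c) (represent y)) ≡ G y
      G-both y = begin
        classify (both (decode c) (represent y))        ≡⟨ cong classify (both-decode c _) ⟩
        classify (represent (G (classify (represent y)))) ≡⟨ classify∘represent _ ⟩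
        G (classify (represent y))                      ≡⟨ cong G (classify∘represent y) ⟩
        G y                                             ∎
      g≗ : onDiagonal (decode c) ≗ lookup g
      g≗ x = inj₁-injective (trans (both-represent (decode c) (inj₁ x)) (G-both (inj₁ x)))
      h≗ : offDiagonal (decode c) ≗ lookup h
      h≗ p = G-both (base p)

    decode∘encode : ∀ f → decode (encode f) ≗ f
    decode∘encode f z = cong proj₁ (begin
      represent (extend (lookup (tabulate (onDiagonal f))) (lookup (tabulate (offDiagonal f)))
                        (classify z))
        ≡⟨ cong represent (extend-cong (lookup∘tabulate _) (lookup∘tabulate _) (classify z)) ⟩
      represent (extend (onDiagonal f) (offDiagonal f) (classify z))
        ≡⟨ cong represent (both-represent f (classify z)) ⟩
      represent (classify (both f (represent (classify z)))) ≡⟨ represent∘classify _ ⟩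
      both f (represent (classify z))                        ≡⟨ cong (both f) (represent∘classify z) ⟩
      both f z                                               ∎)

    counts-idempotents : ∀ {k} → Counts Valid k → Inverse (Idempotents (𝓜 X)) (setoid (Fin k))
    counts-idempotents e = record
      { to        = index
      ; from      = λ i → decode (enum e i) , decode-idempotent (enum e i) (sound e i)
      ; to-cong   = λ {f} {f′} → index-cong {f} {f′}
      ; from-cong = λ { refl _ → refl }
      ; inverse   =
          (λ {i} {f} f≈ → injective e (trans (enum-index f)
             (trans (encode-cong f≈) (encode∘decode (enum e i) (sound e i))))) ,
          (λ { {f} refl z → trans (cong (λ c → decode c z) (enum-index f))
                              (decode∘encode (proj₁ f) z) })
      }
      where
      index : Σ (X × X → X) Idempotent → Fin _
      index (f , idem) = proj₁ (complete e (encode-valid idem))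
      enum-index : ∀ f → enum e (index f) ≡ encode (proj₁ f)
      enum-index (f , idem) = proj₂ (complete e (encode-valid idem))
      index-cong : ∀ {f f′} → proj₁ f ≗ proj₁ f′ → index f ≡ index f′
      index-cong {f} {f′} f≗f′ =
        -- The index is built from the idempotence proof; injectivity of `enum` shows that it
        -- depends only on the values of the operation.
        injective e (trans (enum-index f) (trans (encode-cong f≗f′) (sym (enum-index f′))))

-- The symmetric square of a finite set.

-- In Pairs (suc n), inj₁ j is {0 , suc j}, and inj₂ p is p shifted by suc.
Pairs : ℕ → Set
Pairs zero    = ⊥
Pairs (suc n) = Fin n ⊎ Pairs n

Pairs↔ : ∀ n → Pairs n ↔ Fin (n C 2)
Pairs↔ zero    = ↔-sym 0↔⊥
Pairs↔ (suc n) = subst (λ k → Pairs (suc n) ↔ Fin k)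
  -- Pascal's rule, with `n` read as `n C 1`.
  (trans (cong (_+ n C 2) (sym (nC1≡n n))) (nCk+nC[k+1]≡[n+1]C[k+1] n 1))
  (↔-sym +↔⊎ ↔-∘ (↔-id _ ⊎-↔ Pairs↔ n))

private
  -- Off the diagonal, the boolean is `false` for `i < j` and `true` for `i > j`.
  sort : Fin n × Fin n → Fin n ⊎ Pairs n × Bool
  sort (zero  , zero)  = inj₁ zero
  sort (zero  , suc j) = inj₂ (inj₁ j , false)
  sort (suc i , zero)  = inj₂ (inj₁ i , true)
  sort (suc i , suc j) = Sum.map suc (map₁ inj₂) (sort (i , j))

  unsort : Fin n ⊎ Pairs n × Bool → Fin n × Fin n
  unsort         (inj₁ x)                    = x , x
  unsort {suc n} (inj₂ (inj₁ j , false)) = zero , suc j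
  unsort {suc n} (inj₂ (inj₁ i , true))  = suc i , zero
  unsort {suc n} (inj₂ (inj₂ p , b))     = Product.map suc suc (unsort (inj₂ (p , b)))

  unsort-map : (y : Fin n ⊎ Pairs n × Bool) →
    unsort {suc n} (Sum.map suc (map₁ inj₂) y) ≡ Product.map suc suc (unsort y)
  unsort-map (inj₁ _) = refl
  unsort-map (inj₂ _) = refl

  unsort∘sort : (z : Fin n × Fin n) → unsort (sort z) ≡ z
  unsort∘sort (zero  , zero)  = refl
  unsort∘sort (zero  , suc j) = refl
  unsort∘sort (suc i , zero)  = refl
  unsort∘sort (suc i , suc j) =
    trans (unsort-map (sort (i , j))) (cong (Product.map suc suc) (unsort∘sort (i , j)))

  sort∘unsort : (y : Fin n ⊎ Pairs n × Bool) → sort (unsort y) ≡ y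
  sort∘unsort         (inj₁ zero)            = refl
  sort∘unsort         (inj₁ (suc x))         =
    cong (Sum.map suc (map₁ inj₂)) (sort∘unsort (inj₁ x))
  sort∘unsort {suc n} (inj₂ (inj₁ j , false)) = refl
  sort∘unsort {suc n} (inj₂ (inj₁ i , true))  = refl
  sort∘unsort {suc n} (inj₂ (inj₂ p , b))     =
    cong (Sum.map suc (map₁ inj₂)) (sort∘unsort (inj₂ (p , b)))

  sort-swap : (z : Fin n × Fin n) → sort (swap z) ≡ flip (sort z)
  sort-swap (zero  , zero)  = refl
  sort-swap (zero  , suc j) = refl
  sort-swap (suc i , zero)  = refl
  sort-swap (suc i , suc j) =
    trans (cong (Sum.map suc (map₁ inj₂)) (sort-swap (i , j))) (comm (sort (i , j)))
    where
    comm : (y : Fin n ⊎ Pairs n × Bool) →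
      Sum.map suc (map₁ inj₂) (flip y) ≡
      flip {D = Fin (suc n)} {E = Pairs (suc n)} (Sum.map suc (map₁ inj₂) y)
    comm (inj₁ _) = refl
    comm (inj₂ _) = refl

symmetricSquare : {X : Set ℓ} → X ↔ Fin n → SymmetricSquare X (Fin n) (Fin (n C 2))
symmetricSquare {n = n} φ = record
  { diagonal           = ↔-sym φ
  ; square             = (↔-id _ ⊎-↔ (Pairs↔ n ×-↔ ↔-id _)) ↔-∘
                         (mk↔ₛ′ sort unsort sort∘unsort unsort∘sort ↔-∘ (φ ×-↔ φ))
  ; represent-diagonal = λ _ → refl
  ; classify-swap      = λ (a , b) → let z = Inverse.to φ a , Inverse.to φ b in
      trans (cong relabel (sort-swap z)) (relabel-flip (sort z))
  }
  where
  relabel : Fin n ⊎ Pairs n × Bool → Fin n ⊎ Fin (n C 2) × Bool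
  relabel = Sum.map id (map₁ (Inverse.to (Pairs↔ n)))
  relabel-flip : ∀ y → relabel (flip y) ≡ flip (relabel y)
  relabel-flip (inj₁ _) = refl
  relabel-flip (inj₂ _) = refl

-- The count for an arbitrary finite nonempty set.

theorem23 : ∀ {ℓ} (X : Set ℓ) (n : ℕ) .{{_ : NonZero n}} → X ↔ Fin n →
    let N = n C 2 in
    Inverse (Idempotents (𝓜 X)) (setoid (Fin (
    ∑[ i < n ] (let d = suc (toℕ i) in
    (n C d) * d ^ (n ∸ d) *
    ∑[ j ≤ N ] (let a = toℕ j in
    (N C a) * (2 * a + d) ^ (N ∸ a))))))
theorem23 X n@(suc _) φ =
  -- The count over all subsets has an extra d = 0 term, which reduces to 0 as 0 ^ n does.
  subst (λ k → Inverse (Idempotents (𝓜 X)) (setoid (Fin k))) (sum-cong-≗ {n} term)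
    (counts-idempotents (symmetricSquare φ) counts-Valid)
  where
  N = n C 2
  term : ∀ i → let d = suc (toℕ i) in
    (n C d) * (d ^ (n ∸ d) * ∑[ j ≤ N ] ((N C toℕ j) * (d + toℕ j * 2) ^ (N ∸ toℕ j))) ≡
    (n C d) * d ^ (n ∸ d) * ∑[ j ≤ N ] ((N C toℕ j) * (2 * toℕ j + d) ^ (N ∸ toℕ j))
  term i = let d = suc (toℕ i) in
    trans (sym (*-assoc (n C d) (d ^ (n ∸ d)) _))
      (cong ((n C d) * d ^ (n ∸ d) *_) (sum-cong-≗ {suc N} λ j →
        cong (λ m → (N C toℕ j) * m ^ (N ∸ toℕ j))
          (trans (+-comm d (toℕ j * 2)) (cong (_+ d) (*-comm (toℕ j) 2)))))
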